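{- Let $G$ be a graph with $D(G) \subseteq [a, a+p]$, where $a, p$ are positive integers with $a \geq \frac{p(p-1)}{2}$, or with $D(G) \subseteq [1,4]$. Then $G$ satisfies the Zagreb indices equality $\frac{M_1(G)}{n} = \frac{M_2(G)}{m}$ if (a) $G$ is a regular graph, (b) $G$ is a biregular graph of class 1, (c) $G$ is a disjoint union of $\frac{(p-1)(p+1)}{2}$-regular graphs and a biregular graph of class 1 with degrees of vertices $\frac{(p-1)p}{2}$ and $\frac{p(p+1)}{2}$, where $p$ is odd, or (d) $G$ is a disjoint union of stars $S_5$ and cycles of arbitrary length.
   Context: Graphs are simple and not necessarily connected. For a graph $G=(V,E)$ with $n=|V|$ vertices and $m=|E|$ edges, $d(v)$ denotes the degree of the vertex $v$, $D(G)=\{d(v) : v\in V\}$ is the set of vertex degrees of $G$, and the first and second Zagreb indices are $M_1(G)=\sum_{v\in V} d(v)^2$ and $M_2(G)=\sum_{uv\in E} d(u)d(v)$. Intervals $[s,t]$ are intervals of integers. A graph is regular if all its vertices have the same degree, and $k$-regular if that degree is $k$. A graph is biregular if its vertex degrees assume exactly two distinct values; it is biregular of class 1 if, in addition, no two vertices of the same degree are adjacent. $S_5$ is the star on 5 vertices, i.e. $K_{1,4}$. -}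

module Defs where

open import Data.Empty using (⊥)
open import Data.Fin using (Fin; toℕ; splitAt)
open import Data.Fin.Properties using (_<?_; toℕ<n)
open import Data.Integer using (+_)
open import Data.List using (List; allFin; cartesianProduct; filter; foldr; length; map)
open import Data.List.Relation.Unary.All using (All)
open import Data.Nat using (ℕ; suc; _+_; _*_; _^_; _%_; _≤_; NonZero)
open import Data.Nat.DivMod using (m<n⇒m%n≡m; n%n≡0)
open import Data.Nat.ListAction using (sum)
open import Data.Nat.Properties using (_≟_; 1+n≢n; m≤n⇒m<n∨m≡n)
open import Data.Product using (Σ-syntax; ∃; ∃₂; ∃-syntax; _×_; _,_)
open import Data.Rational using (_/_)
open import Data.Sum using (_⊎_; inj₁; inj₂; swap)
open import Data.Sum.Relation.Binary.Pointwise using (Pointwise; inj₁; inj₂; ⊎-symmetric; ⊎-decidable)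
open import Function.Bundles using (_↔_; _⇔_; Inverse)
open import Level using (0ℓ)
open import Relation.Binary using (Rel; Decidable; Symmetric; Irreflexive)
open import Relation.Binary.PropositionalEquality as ≡ using (_≡_; _≢_; refl)
open import Relation.Nullary using (¬_; yes; no)
open import Relation.Nullary.Decidable using (_×-dec_; _⊎-dec_)
open import Relation.Unary using (Pred; _∪_; ｛_｝; _≐_)

record Graph : Set₁ where
  field
    order  : ℕ
    Adj    : Rel (Fin order) 0ℓ
    Adj?   : Decidable Adj
    sym    : Symmetric Adj
    irrefl : Irreflexive _≡_ Adj

  Vertex : Set
  Vertex = Fin order

  degree : Vertex → ℕ
  degree v = length (filter (Adj? v) (allFin order))

  -- Each undirected edge is listed once, as the pair (u , v) with u < v.
  edges : List (Vertex × Vertex)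
  edges = filter (λ (u , v) → (u <? v) ×-dec Adj? u v)
                 (cartesianProduct (allFin order) (allFin order))

  size : ℕ
  size = length edges

  D : Pred ℕ 0ℓ
  D k = ∃[ v ] degree v ≡ k

  M₁ : ℕ
  M₁ = sum (map (λ v → degree v ^ 2) (allFin order))

  M₂ : ℕ
  M₂ = sum (map (λ (u , v) → degree u * degree v) edges)

open Graph

[_⋯_] : ℕ → ℕ → Pred ℕ 0ℓ
[ s ⋯ t ] k = s ≤ k × k ≤ t

-- The first component says that M₂ / m is a genuine quotient.
ZagrebEquality : (G : Graph) → .{{NonZero (order G)}} → Set
ZagrebEquality G =
  Σ[ m≢0 ∈ NonZero (size G) ] (+ M₁ G / order G) ≡ (+ M₂ G / size G) {{m≢0}}

RegularOf : ℕ → Graph → Set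
RegularOf k G = ∀ v → degree G v ≡ k

Regular : Graph → Set
Regular G = ∃[ k ] RegularOf k G

BiregularOf : ℕ → ℕ → Graph → Set
BiregularOf x y G = x ≢ y × D G ≐ (｛ x ｝ ∪ ｛ y ｝)

BiregularOfClass1 : ℕ → ℕ → Graph → Set
BiregularOfClass1 x y G =
  BiregularOf x y G × (∀ u v → degree G u ≡ degree G v → ¬ Adj G u v)

BiregularClass1 : Graph → Set
BiregularClass1 G = ∃₂ λ x y → BiregularOfClass1 x y G

infix 4 _≅_

record _≅_ (G H : Graph) : Set where
  field
    vertices : Vertex G ↔ Vertex H
    adj      : ∀ u v → Adj G u v ⇔ Adj H (Inverse.to vertices u) (Inverse.to vertices v)

infixr 6 _⊔ᴳ_

_⊔ᴳ_ : Graph → Graph → Graph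
G ⊔ᴳ H = record
  { order  = order G + order H
  ; Adj    = λ i j → Pointwise (Adj G) (Adj H) (splitAt (order G) i) (splitAt (order G) j)
  ; Adj?   = λ i j → ⊎-decidable (Adj? G) (Adj? H) (splitAt (order G) i) (splitAt (order G) j)
  ; sym    = ⊎-symmetric (Graph.sym G) (Graph.sym H)
  ; irrefl = λ { {i} refl → irr (splitAt (order G) i) }
  }
  where
  irr : ∀ x → ¬ Pointwise (Adj G) (Adj H) x x
  irr (inj₁ u) (inj₁ e) = irrefl G refl e
  irr (inj₂ v) (inj₂ e) = irrefl H refl e

emptyGraph : Graph
emptyGraph = record
  { order  = 0
  ; Adj    = λ _ _ → ⊥
  ; Adj?   = λ _ _ → no λ ()
  ; sym    = λ ()
  ; irrefl = λ _ ()
  }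

⨆ : List Graph → Graph
⨆ = foldr _⊔ᴳ_ emptyGraph

data Across {A B : Set} : Rel (A ⊎ B) 0ℓ where
  l→r : ∀ {a b} → Across (inj₁ a) (inj₂ b)
  r→l : ∀ {a b} → Across (inj₂ b) (inj₁ a)

completeBipartite : ℕ → ℕ → Graph
completeBipartite m n = record
  { order  = m + n
  ; Adj    = λ i j → Across (splitAt m i) (splitAt m j)
  ; Adj?   = λ i j → across? (splitAt m i) (splitAt m j)
  ; sym    = symm
  ; irrefl = λ { {i} refl → irr (splitAt m i) }
  }
  where
  across? : Decidable (Across {Fin m} {Fin n})
  across? (inj₁ _) (inj₁ _) = no λ ()
  across? (inj₁ _) (inj₂ _) = yes l→r
  across? (inj₂ _) (inj₁ _) = yes r→l
  across? (inj₂ _) (inj₂ _) = no λ ()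

  symm : Symmetric (Across {Fin m} {Fin n})
  symm l→r = r→l
  symm r→l = l→r

  irr : (x : Fin m ⊎ Fin n) → ¬ Across x x
  irr (inj₁ _) ()
  irr (inj₂ _) ()

S₅ : Graph
S₅ = completeBipartite 1 4

-- cycle ℓ has 3 + ℓ vertices, so every length of a cycle in a simple graph occurs.
cycle : ℕ → Graph
cycle ℓ = record
  { order  = k
  ; Adj    = λ i j → Next i j ⊎ Next j i
  ; Adj?   = λ i j → (toℕ j ≟ suc (toℕ i) % k) ⊎-dec (toℕ i ≟ suc (toℕ j) % k)
  ; sym    = swap
  ; irrefl = λ { {i} refl (inj₁ e) → irr i e ; {i} refl (inj₂ e) → irr i e }
  }
  where
  k : ℕ
  k = 3 + ℓ

  Next : Rel (Fin k) 0ℓ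
  Next i j = toℕ j ≡ suc (toℕ i) % k

  irr : ∀ i → ¬ Next i i
  irr i e with m≤n⇒m<n∨m≡n (toℕ<n i)
  ... | inj₁ 1+i<k = 1+n≢n (≡.sym (≡.trans e (m<n⇒m%n≡m 1+i<k)))
  ... | inj₂ 1+i≡k
    with () ← ≡.trans (≡.sym 1+i≡k)
                (≡.cong suc (≡.trans e (≡.trans (≡.cong (_% k) 1+i≡k) (n%n≡0 k))))

StarsAndCycles : Graph → Set₁
StarsAndCycles G =
  ∃[ Hs ] All (λ H → H ≅ S₅ ⊎ ∃[ ℓ ] H ≅ cycle ℓ) Hs × G ≅ ⨆ Hs

RegularsAndBiregular : ℕ → ℕ → ℕ → Graph → Set₁
RegularsAndBiregular k x y G =
  ∃₂ λ Hs B → All (RegularOf k) Hs × BiregularOfClass1 x y B × G ≅ ⨆ Hs ⊔ᴳ B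

{-# OPTIONS --safe #-}

-- With reciprocal degrees as weights, each quantity in the equality is a sum over the edges uv:
--   n = Σ (1/d(u) + 1/d(v)),   M₁ = Σ (d(u) + d(v)),   m = Σ 1,   M₂ = Σ d(u) d(v).
-- Since d(u) + d(v) = d(u) d(v) (1/d(u) + 1/d(v)), the equality M₁/n = M₂/m holds as soon as one of
-- the following is the same for all edges:
--   the product d(u) d(v), as in (a), (b) and (d), where in (d) it is 4 on stars and on cycles;
--   the ratio (d(u) + d(v)) : d(u) d(v), as in (c), where it is 4 : (p² - 1) on both kinds of component.
module Submission where

open import Defs
import Algebra.Properties.CommutativeSemigroup
import Algebra.Properties.Semiring.Sum
open import Data.Bool using (true; false; if_then_else_)
open import Data.Fin using (Fin; zero; suc; toℕ; fromℕ<; splitAt; _↑ˡ_; _↑ʳ_)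
open import Data.Fin.Properties
  using (_<?_; <-cmp; all?; toℕ<n; toℕ-fromℕ<; toℕ-injective; splitAt-↑ˡ; splitAt-↑ʳ)
  renaming (_≟_ to _≟ᶠ_)
import Data.Integer as ℤ
open import Data.Integer.Properties using (pos-*)
open import Data.List using (List; []; _∷_; allFin; _++_; cartesianProduct; filter; length; map; tabulate)
open import Data.List.Membership.Propositional.Properties using (∈-map⁺; ∈-allFin)
open import Data.List.Properties using (map-++; map-∘; map-tabulate)
open import Data.List.Relation.Unary.All as All using (All; []; _∷_)
open import Data.List.Relation.Unary.All.Properties as All using (all-filter)
open import Data.Nat using (ℕ; zero; suc; _+_; _*_; _∸_; _/_; _%_; _^_; _≤_; _<_; s≤s; NonZero;
  ≢-nonZero; ≢-nonZero⁻¹; >-nonZero)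
open import Data.Nat.DivMod using (m≡m%n+[m/n]*n; m%n<n; m<n⇒m%n≡m; m%n%n≡m%n; [m+n]%n≡m%n; %-distribˡ-+; m*n/n≡m)
open import Data.Nat.Divisibility using (_∣_; _∤_; divides)
open import Data.Nat.ListAction using (sum; product)
open import Data.Nat.ListAction.Properties using (sum-++; ∈⇒∣product; product≢0)
open import Data.Nat.Properties
  using (_≟_; +-*-semiring; *-commutativeSemigroup; +-identityʳ; +-assoc; +-comm; +-suc; +-cancelˡ-≡;
    *-identityˡ; *-identityʳ; *-zeroʳ; *-comm; *-assoc; *-distribˡ-+; *-cancelˡ-≡; m+n≡0⇒m≡0; m*n≢0; ≤-trans)
open import Data.Nat.Tactic.RingSolver using (solve-∀)
open import Data.Product using (∃-syntax; _×_; _,_; proj₁; proj₂)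
import Data.Rational as ℚ
open import Data.Rational.Properties using (fromℚᵘ-cong)
open import Data.Rational.Unnormalised using (mkℚᵘ; *≡*)
open import Data.Sum using (_⊎_; inj₁; inj₂; [_,_]′)
open import Data.Sum.Relation.Binary.Pointwise using (Pointwise; inj₁; inj₂)
open import Function using (_∘_; id; it)
open import Function.Bundles using (_⇔_; Equivalence; Inverse; mk⇔)
open import Relation.Binary using (tri<; tri≈; tri>)
open import Relation.Binary.PropositionalEquality using (_≡_; _≢_; refl; sym; trans; cong; cong₂; subst₂; module ≡-Reasoning)
open import Relation.Nullary using (Dec; yes; no; does; ¬_; contradiction)
open import Relation.Nullary.Decidable using (_×-dec_; _⊎-dec_; _→-dec_; from-yes; dec-false; does-⇔)
open import Relation.Unary as Unary using (Pred; _⊆_)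
open Graph using (order; D; Adj; Adj?; Vertex; degree; edges; size; M₁; M₂)
module ∑ = Algebra.Properties.Semiring.Sum +-*-semiring
open ∑ using (sum-syntax)
module *-CS = Algebra.Properties.CommutativeSemigroup *-commutativeSemigroup
open _≅_ using (vertices; adj)
open ≡-Reasoning

-- Indicators of decidable propositions, which turn counting into summation

ι : ∀ {P : Set} → Dec P → ℕ
ι P? = if does P? then 1 else 0

ι-no : ∀ {P : Set} (P? : Dec P) → ¬ P → ι P? ≡ 0
ι-no P? ¬p = cong (if_then 1 else 0) (dec-false P? ¬p)

ι-cong : ∀ {P Q : Set} → P ⇔ Q → (P? : Dec P) (Q? : Dec Q) → ι P? ≡ ι Q?
ι-cong P⇔Q P? Q? = cong (if_then 1 else 0) (does-⇔ P⇔Q P? Q?)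

ι-⊎ : ∀ {P Q : Set} → (P → ¬ Q) → (P? : Dec P) (Q? : Dec Q) → ι (P? ⊎-dec Q?) ≡ ι P? + ι Q?
ι-⊎ P⇒¬Q (yes p) Q? = cong suc (sym (ι-no Q? (P⇒¬Q p)))
ι-⊎ P⇒¬Q (no _)  Q? = refl

-- Sums over lists and over finite sets

length-filter-ι : ∀ {A : Set} {P : Pred A _} (P? : Unary.Decidable P) xs →
                  length (filter P? xs) ≡ sum (map (ι ∘ P?) xs)
length-filter-ι P? []       = refl
length-filter-ι P? (x ∷ xs) with does (P? x)
... | true  = cong suc (length-filter-ι P? xs)
... | false = length-filter-ι P? xs

sum-map-filter : ∀ {A : Set} {P : Pred A _} (P? : Unary.Decidable P) (f : A → ℕ) xs →
                 sum (map f (filter P? xs)) ≡ sum (map (λ x → ι (P? x) * f x) xs)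
sum-map-filter P? f []       = refl
sum-map-filter P? f (x ∷ xs) with does (P? x)
... | true  = cong₂ _+_ (sym (*-identityˡ (f x))) (sum-map-filter P? f xs)
... | false = sum-map-filter P? f xs

sum-map-cartesianProduct : ∀ {A B : Set} (f : A × B → ℕ) xs ys →
  sum (map f (cartesianProduct xs ys)) ≡ sum (map (λ x → sum (map (λ y → f (x , y)) ys)) xs)
sum-map-cartesianProduct f []       ys = refl
sum-map-cartesianProduct f (x ∷ xs) ys = begin
  sum (map f (map (x ,_) ys ++ cartesianProduct xs ys))
    ≡⟨ cong sum (map-++ f (map (x ,_) ys) _) ⟩
  sum (map f (map (x ,_) ys) ++ map f (cartesianProduct xs ys))
    ≡⟨ sum-++ (map f (map (x ,_) ys)) _ ⟩
  sum (map f (map (x ,_) ys)) + sum (map f (cartesianProduct xs ys))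
    ≡⟨ cong₂ _+_ (cong sum (sym (map-∘ ys))) (sum-map-cartesianProduct f xs ys) ⟩
  sum (map (λ y → f (x , y)) ys) + sum (map (λ x → sum (map (λ y → f (x , y)) ys)) xs) ∎

-- A multiplier on each side expresses proportionality without division, so that everything stays in
-- the natural numbers.
sum-map-proportional : ∀ {A : Set} a b (f g : A → ℕ) {xs} → All (λ x → a * f x ≡ b * g x) xs →
                       a * sum (map f xs) ≡ b * sum (map g xs)
sum-map-proportional a b f g []                 = trans (*-zeroʳ a) (sym (*-zeroʳ b))
sum-map-proportional a b f g {x ∷ xs} (px ∷ pxs) = begin
  a * (f x + sum (map f xs))     ≡⟨ *-distribˡ-+ a (f x) _ ⟩
  a * f x + a * sum (map f xs)   ≡⟨ cong₂ _+_ px (sum-map-proportional a b f g pxs) ⟩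
  b * g x + b * sum (map g xs)   ≡⟨ *-distribˡ-+ b (g x) _ ⟨
  b * (g x + sum (map g xs))     ∎

sum-map-1 : ∀ {A : Set} (xs : List A) → sum (map (λ _ → 1) xs) ≡ length xs
sum-map-1 []       = refl
sum-map-1 (_ ∷ xs) = cong suc (sum-map-1 xs)

sum-tabulate : ∀ {n} (f : Fin n → ℕ) → sum (tabulate f) ≡ ∑[ i < n ] f i
sum-tabulate {zero}  f = refl
sum-tabulate {suc n} f = cong (f zero +_) (sum-tabulate (f ∘ suc))

sum-map-allFin : ∀ {n} (f : Fin n → ℕ) → sum (map f (allFin n)) ≡ ∑[ i < n ] f i
sum-map-allFin f = trans (cong sum (map-tabulate id f)) (sum-tabulate f)

∑-const : ∀ n c → ∑[ i < n ] c ≡ n * c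
∑-const zero    c = refl
∑-const (suc n) c = cong (c +_) (∑-const n c)

∑-+ : ∀ m n (f : Fin (m + n) → ℕ) →
      ∑[ i < m + n ] f i ≡ ∑[ i < m ] f (i ↑ˡ n) + ∑[ j < n ] f (m ↑ʳ j)
∑-+ zero    n f = refl
∑-+ (suc m) n f = trans (cong (f zero +_) (∑-+ m n (f ∘ suc))) 
  (sym (+-assoc (f zero) (∑[ i < m ] f (suc i ↑ˡ n)) (∑[ j < n ] f (suc m ↑ʳ j))))

∑-ι-≟ : ∀ {n} (x : Fin n) → ∑[ j < n ] ι (j ≟ᶠ x) ≡ 1
∑-ι-≟ {suc n} zero    = cong suc (trans (∑.sum-cong-≗ {n} {y = λ _ → 0} (λ j → ι-no (suc j ≟ᶠ zero) λ ())) (∑.sum-replicate-zero n))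
∑-ι-≟ {suc n} (suc x) = trans
  (∑.sum-cong-≗ λ j → ι-cong (mk⇔ (λ { refl → refl }) (cong suc)) (suc j ≟ᶠ suc x) (j ≟ᶠ x))
  (∑-ι-≟ x)

∑-ι-unique : ∀ {n} {P : Pred (Fin n) _} (P? : Unary.Decidable P) x → (∀ j → P j ⇔ j ≡ x) →
             ∑[ j < n ] ι (P? j) ≡ 1
∑-ι-unique P? x P⇔ = trans (∑.sum-cong-≗ λ j → ι-cong (P⇔ j) (P? j) (j ≟ᶠ x)) (∑-ι-≟ x)

-- Double counting

degree-∑ : ∀ G u → degree G u ≡ ∑[ v < order G ] ι (Adj? G u v)
degree-∑ G u = trans (length-filter-ι (Adj? G u) (allFin (order G))) (sum-map-allFin (ι ∘ Adj? G u))

edgeSum : (G : Graph) → (Vertex G → Vertex G → ℕ) → ℕ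
edgeSum G f = sum (map (λ (u , v) → f u v) (edges G))

module _ (G : Graph) where

  private
    n = order G
    d = degree G

    edge? : ∀ u v → Dec (toℕ u < toℕ v × Adj G u v)
    edge? u v = (u <? v) ×-dec Adj? G u v

  edgeSum-∑ : ∀ (f : Vertex G → Vertex G → ℕ) → edgeSum G f ≡ ∑[ u < n ] ∑[ v < n ] (ι (edge? u v) * f u v)
  edgeSum-∑ f = begin
    edgeSum G f
      ≡⟨ sum-map-filter (λ (u , v) → edge? u v) _ (cartesianProduct (allFin n) (allFin n)) ⟩
    sum (map (λ (u , v) → ι (edge? u v) * f u v) (cartesianProduct (allFin n) (allFin n)))
      ≡⟨ sum-map-cartesianProduct _ (allFin n) (allFin n) ⟩
    sum (map (λ u → sum (map (λ v → ι (edge? u v) * f u v) (allFin n))) (allFin n))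
      ≡⟨ sum-map-allFin (λ u → sum (map (λ v → ι (edge? u v) * f u v) (allFin n))) ⟩
    ∑[ u < n ] sum (map (λ v → ι (edge? u v) * f u v) (allFin n))
      ≡⟨ ∑.sum-cong-≗ (λ u → sum-map-allFin (λ v → ι (edge? u v) * f u v)) ⟩
    ∑[ u < n ] ∑[ v < n ] (ι (edge? u v) * f u v) ∎

  -- By trichotomy an adjacent pair appears in `edges` in exactly one of its two orientations; the
  -- diagonal contributes nothing because adjacency is irreflexive.
  ι-Adj : ∀ u v → ι (Adj? G u v) ≡ ι (edge? u v) + ι (edge? v u)
  ι-Adj u v with <-cmp u v
  ... | tri< u<v _ v≮u = begin
    ι (Adj? G u v)                   ≡⟨ ι-cong (mk⇔ (u<v ,_) proj₂) (Adj? G u v) (edge? u v) ⟩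
    ι (edge? u v)                    ≡⟨ +-identityʳ _ ⟨
    ι (edge? u v) + 0                ≡⟨ cong (ι (edge? u v) +_) (ι-no (edge? v u) (v≮u ∘ proj₁)) ⟨
    ι (edge? u v) + ι (edge? v u)    ∎
  ... | tri> u≮v _ v<u = begin
    ι (Adj? G u v)                   ≡⟨ ι-cong (mk⇔ (λ e → v<u , Graph.sym G e) (Graph.sym G ∘ proj₂))
                                               (Adj? G u v) (edge? v u) ⟩
    ι (edge? v u)                    ≡⟨ cong (_+ ι (edge? v u)) (ι-no (edge? u v) (u≮v ∘ proj₁)) ⟨
    ι (edge? u v) + ι (edge? v u)    ∎
  ... | tri≈ u≮v refl _ = begin
    ι (Adj? G u u)                   ≡⟨ ι-no (Adj? G u u) (Graph.irrefl G refl) ⟩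
    0                                ≡⟨ cong₂ _+_ (ι-no (edge? u u) (u≮v ∘ proj₁)) (ι-no (edge? u u) (u≮v ∘ proj₁)) ⟨
    ι (edge? u u) + ι (edge? u u)    ∎

  -- Writing `d u` as a count of neighbours, an edge `uv` is met once from `u`, with weight `f u`,
  -- and once from `v`, with weight `f v`. The choices `f = d`, `f = 1` and `f` a multiple of the
  -- reciprocal degree yield the counts needed later.
  handshake : ∀ (f : Vertex G → ℕ) → ∑[ u < n ] (f u * d u) ≡ edgeSum G (λ u v → f u + f v)
  handshake f = begin
    ∑[ u < n ] (f u * d u)
      ≡⟨ ∑.sum-cong-≗ (λ u → trans (cong (f u *_) (degree-∑ G u)) (∑.*-distribˡ-sum (f u) (λ v → ι (Adj? G u v)))) ⟩
    ∑[ u < n ] ∑[ v < n ] (f u * ι (Adj? G u v))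
      ≡⟨ ∑.sum-cong-≗ (λ u → ∑.sum-cong-≗ λ v → begin
           f u * ι (Adj? G u v)                          ≡⟨ cong (f u *_) (ι-Adj u v) ⟩
           f u * (ι (edge? u v) + ι (edge? v u))         ≡⟨ expand (f u) (ι (edge? u v)) (ι (edge? v u)) ⟩
           ι (edge? u v) * f u + ι (edge? v u) * f u     ∎) ⟩
    ∑[ u < n ] ∑[ v < n ] (ι (edge? u v) * f u + ι (edge? v u) * f u)
      ≡⟨ split (λ u v → ι (edge? u v) * f u) (λ u v → ι (edge? v u) * f u) ⟩
    ∑[ u < n ] ∑[ v < n ] (ι (edge? u v) * f u) + ∑[ u < n ] ∑[ v < n ] (ι (edge? v u) * f u)
      -- Exchanging the two sums and renaming the variables turns the reversed orientation with
      -- weight `f u` into the listed one with weight `f v`.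
      ≡⟨ cong (∑[ u < n ] ∑[ v < n ] (ι (edge? u v) * f u) +_) (∑.∑-comm (λ u v → ι (edge? v u) * f u)) ⟩
    ∑[ u < n ] ∑[ v < n ] (ι (edge? u v) * f u) + ∑[ u < n ] ∑[ v < n ] (ι (edge? u v) * f v)
      ≡⟨ split (λ u v → ι (edge? u v) * f u) (λ u v → ι (edge? u v) * f v) ⟨
    ∑[ u < n ] ∑[ v < n ] (ι (edge? u v) * f u + ι (edge? u v) * f v)
      ≡⟨ ∑.sum-cong-≗ (λ u → ∑.sum-cong-≗ λ v → *-distribˡ-+ (ι (edge? u v)) (f u) (f v)) ⟨
    ∑[ u < n ] ∑[ v < n ] (ι (edge? u v) * (f u + f v))
      ≡⟨ edgeSum-∑ (λ u v → f u + f v) ⟨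
    edgeSum G (λ u v → f u + f v) ∎
    where
    expand : ∀ x a b → x * (a + b) ≡ a * x + b * x
    expand = solve-∀

    split : ∀ (g h : Fin n → Fin n → ℕ) →
            ∑[ u < n ] ∑[ v < n ] (g u v + h u v) ≡ ∑[ u < n ] ∑[ v < n ] g u v + ∑[ u < n ] ∑[ v < n ] h u v
    split g h = trans (∑.sum-cong-≗ λ u → ∑.∑-distrib-+ (g u) (h u)) (∑.∑-distrib-+ (λ u → ∑.sum (g u)) (λ u → ∑.sum (h u)))

  -- The relation is required only for adjacent pairs: every pair in `edges` has passed the filter
  -- and so carries a proof of adjacency.
  edgeSum-proportional : ∀ a b (f g : Vertex G → Vertex G → ℕ) → (∀ {u v} → Adj G u v → a * f u v ≡ b * g u v) →
                         a * edgeSum G f ≡ b * edgeSum G g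
  edgeSum-proportional a b f g h =
    sum-map-proportional a b (λ (u , v) → f u v) (λ (u , v) → g u v)
      (All.map (h ∘ proj₂) (all-filter (λ (u , v) → edge? u v) (cartesianProduct (allFin n) (allFin n))))

  size-edgeSum : size G ≡ edgeSum G (λ _ _ → 1)
  size-edgeSum = sym (sum-map-1 (edges G))

  M₁-edgeSum : M₁ G ≡ edgeSum G (λ u v → d u + d v)
  M₁-edgeSum = begin
    M₁ G                     ≡⟨ sum-map-allFin (λ v → d v ^ 2) ⟩
    ∑[ v < n ] (d v ^ 2)     ≡⟨ ∑.sum-cong-≗ (λ v → cong (d v *_) (*-identityʳ (d v))) ⟩
    ∑[ v < n ] (d v * d v)   ≡⟨ handshake d ⟩
    edgeSum G (λ u v → d u + d v) ∎

-- Two edge conditions that imply the cross-multiplied equality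

Edgewise : (ℕ → ℕ → Set) → Graph → Set
Edgewise Q G = ∀ {u v} → Adj G u v → Q (degree G u) (degree G v)

-- N is a common multiple of the degrees, and w v stands for N / d v.
module _ (G : Graph) (N : ℕ) {{_ : NonZero N}} (w : Vertex G → ℕ)
         (w*d≡N : ∀ v → w v * degree G v ≡ N) where

  private
    n = order G
    m = size G
    d = degree G

  -- The sum of the reciprocal degrees over the edge ends, with denominators cleared: under the
  -- weights `w` every vertex contributes exactly `N`.
  order-edgeSum : N * n ≡ edgeSum G (λ u v → w u + w v)
  order-edgeSum = begin
    N * n                      ≡⟨ *-comm N n ⟩
    n * N                      ≡⟨ ∑-const n N ⟨
    ∑[ v < n ] N               ≡⟨ ∑.sum-cong-≗ w*d≡N ⟨
    ∑[ v < n ] (w v * d v)     ≡⟨ handshake G w ⟩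
    edgeSum G (λ u v → w u + w v) ∎

  -- This is `(1/x + 1/y) * xy = x + y` for the two degrees, multiplied through by `N`.
  weights-sum : ∀ u v → (w u + w v) * (d u * d v) ≡ N * (d u + d v)
  weights-sum u v = begin
    (w u + w v) * (d u * d v)              ≡⟨ regroup (w u) (w v) (d u) (d v) ⟩
    (w u * d u) * d v + (w v * d v) * d u  ≡⟨ cong₂ (λ x y → x * d v + y * d u) (w*d≡N u) (w*d≡N v) ⟩
    N * d v + N * d u                      ≡⟨ collect N (d u) (d v) ⟩
    N * (d u + d v)                        ∎
    where
    regroup : ∀ a b x y → (a + b) * (x * y) ≡ (a * x) * y + (b * y) * x
    regroup = solve-∀
    collect : ∀ N x y → N * y + N * x ≡ N * (x + y)
    collect = solve-∀

  -- Both quotients equal `c`: summing over the edges gives `M₁ = c * n` by `weights-sum`, and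
  -- `M₂ = c * m` directly.
  constant-product : ∀ c → Edgewise (λ x y → x * y ≡ c) G → M₁ G * m ≡ M₂ G * n
  constant-product c prod = begin
    M₁ G * m       ≡⟨ cong (_* m) M₁≡cn ⟩
    c * n * m      ≡⟨ *-CS.xy∙z≈xz∙y c n m ⟩
    c * m * n      ≡⟨ cong (_* n) M₂≡cm ⟨
    M₂ G * n       ∎
    where
    M₁≡cn : M₁ G ≡ c * n
    M₁≡cn = *-cancelˡ-≡ _ _ N (begin
      N * M₁ G                              ≡⟨ cong (N *_) (M₁-edgeSum G) ⟩
      N * edgeSum G (λ u v → d u + d v)     ≡⟨ edgeSum-proportional G N c _ _ (λ {u} {v} e → begin
        N * (d u + d v)                         ≡⟨ weights-sum u v ⟨
        (w u + w v) * (d u * d v)               ≡⟨ cong ((w u + w v) *_) (prod e) ⟩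
        (w u + w v) * c                         ≡⟨ *-comm (w u + w v) c ⟩
        c * (w u + w v)                         ∎) ⟩
      c * edgeSum G (λ u v → w u + w v)     ≡⟨ cong (c *_) order-edgeSum ⟨
      c * (N * n)                           ≡⟨ *-CS.x∙yz≈y∙xz c N n ⟩
      N * (c * n)                           ∎)

    M₂≡cm : M₂ G ≡ c * m
    M₂≡cm = begin
      M₂ G                            ≡⟨ *-identityˡ _ ⟨
      1 * M₂ G                        ≡⟨ edgeSum-proportional G 1 c (λ u v → d u * d v) (λ _ _ → 1)
                                           (λ e → trans (*-identityˡ _) (trans (prod e) (sym (*-identityʳ c)))) ⟩
      c * edgeSum G (λ _ _ → 1)       ≡⟨ cong (c *_) (size-edgeSum G) ⟨
      c * m                           ∎

  -- The ratio passes to the sums twice: `k * M₁ = l * M₂` directly, and `k * n = l * m` because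
  -- `1/d u + 1/d v` is the constant `l/k` on edges when `k` is positive. Positive degrees allow the
  -- product `d u * d v` to be cancelled.
  constant-ratio : ∀ k l {{_ : NonZero l}} → (∀ v → NonZero (d v)) →
                   Edgewise (λ x y → k * (x + y) ≡ l * (x * y)) G → M₁ G * m ≡ M₂ G * n
  constant-ratio k l d≢0 ratio = *-cancelˡ-≡ _ _ l (begin
    l * (M₁ G * m)   ≡⟨ *-CS.x∙yz≈y∙xz l (M₁ G) m ⟩
    M₁ G * (l * m)   ≡⟨ cong (M₁ G *_) kn≡lm ⟨
    M₁ G * (k * n)   ≡⟨ *-CS.x∙yz≈yx∙z (M₁ G) k n ⟩
    (k * M₁ G) * n   ≡⟨ cong (_* n) kM₁≡lM₂ ⟩
    (l * M₂ G) * n   ≡⟨ *-assoc l (M₂ G) n ⟩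
    l * (M₂ G * n)   ∎)
    where
    -- The factor `1` is the summand whose edge sum is the size.
    edge-weights : ∀ {u v} → Adj G u v → k * (w u + w v) ≡ (l * N) * 1
    edge-weights {u} {v} e =
      *-cancelˡ-≡ _ _ (d u * d v) {{m*n≢0 (d u) (d v) {{d≢0 u}} {{d≢0 v}}}} (begin
        (d u * d v) * (k * (w u + w v))    ≡⟨ *-CS.x∙yz≈y∙zx (d u * d v) k (w u + w v) ⟩
        k * ((w u + w v) * (d u * d v))    ≡⟨ cong (k *_) (weights-sum u v) ⟩
        k * (N * (d u + d v))              ≡⟨ *-CS.x∙yz≈y∙xz k N (d u + d v) ⟩
        N * (k * (d u + d v))              ≡⟨ cong (N *_) (ratio e) ⟩
        N * (l * (d u * d v))              ≡⟨ regroup N l (d u * d v) ⟩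
        (d u * d v) * ((l * N) * 1)        ∎)
      where
      regroup : ∀ a b c → a * (b * c) ≡ c * ((b * a) * 1)
      regroup = solve-∀

    kn≡lm : k * n ≡ l * m
    kn≡lm = *-cancelˡ-≡ _ _ N (begin
      N * (k * n)                           ≡⟨ *-CS.x∙yz≈y∙xz N k n ⟩
      k * (N * n)                           ≡⟨ cong (k *_) order-edgeSum ⟩
      k * edgeSum G (λ u v → w u + w v)     ≡⟨ edgeSum-proportional G k (l * N) _ _ edge-weights ⟩
      (l * N) * edgeSum G (λ _ _ → 1)       ≡⟨ cong ((l * N) *_) (size-edgeSum G) ⟨
      (l * N) * m                           ≡⟨ *-CS.x∙yz≈yx∙z N l m ⟨
      N * (l * m)                           ∎)

    kM₁≡lM₂ : k * M₁ G ≡ l * M₂ G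
    kM₁≡lM₂ = trans (cong (k *_) (M₁-edgeSum G)) (edgeSum-proportional G k l _ _ ratio)

-- Degrees in isomorphic graphs and in disjoint unions

-- The vertex bijection permutes the terms of the sum that counts neighbours.
degree-≅ : ∀ {G H} (i : G ≅ H) u → degree G u ≡ degree H (Inverse.to (vertices i) u)
degree-≅ {G} {H} i u = begin
  degree G u                                          ≡⟨ degree-∑ G u ⟩
  ∑[ v < order G ] ι (Adj? G u v)                     ≡⟨ ∑.sum-cong-≗ (λ v → ι-cong (adj i u v) (Adj? G u v) (Adj? H (to u) (to v))) ⟩
  ∑[ v < order G ] ι (Adj? H (to u) (to v))           ≡⟨ ∑.sum-permute (λ v → ι (Adj? H (to u) v)) (vertices i) ⟨
  ∑[ v < order H ] ι (Adj? H (to u) v)                ≡⟨ degree-∑ H (to u) ⟨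
  degree H (to u)                                     ∎
  where open Inverse (vertices i) using (to)

module _ (G H : Graph) where

  private
    g = order G
    h = order H

  -- The neighbour count splits into two blocks, and the block of `H` vanishes. The vertex is given
  -- through an equation on `splitAt` since adjacency in the union is defined by that case
  -- distinction.
  degree-⊔ˡ : ∀ {i u} → splitAt g {h} i ≡ inj₁ u → degree (G ⊔ᴳ H) i ≡ degree G u
  degree-⊔ˡ {i} {u} i≡u = begin
    degree (G ⊔ᴳ H) i
      ≡⟨ degree-∑ (G ⊔ᴳ H) i ⟩
    ∑[ j < g + h ] ι (Adj? (G ⊔ᴳ H) i j)
      ≡⟨ ∑-+ g h _ ⟩
    ∑[ v < g ] ι (Adj? (G ⊔ᴳ H) i (v ↑ˡ h)) + ∑[ v < h ] ι (Adj? (G ⊔ᴳ H) i (g ↑ʳ v))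
      ≡⟨ cong₂ _+_ (∑.sum-cong-≗ λ v → ι-cong (left v) (Adj? (G ⊔ᴳ H) i (v ↑ˡ h)) (Adj? G u v))
                   (∑.sum-cong-≗ λ v → ι-no (Adj? (G ⊔ᴳ H) i (g ↑ʳ v)) (right v)) ⟩
    ∑[ v < g ] ι (Adj? G u v) + ∑[ v < h ] 0
      ≡⟨ cong₂ _+_ (sym (degree-∑ G u)) (∑.sum-replicate-zero h) ⟩
    degree G u + 0
      ≡⟨ +-identityʳ _ ⟩
    degree G u ∎
    where
    left : ∀ v → Adj (G ⊔ᴳ H) i (v ↑ˡ h) ⇔ Adj G u v
    left v rewrite i≡u | splitAt-↑ˡ g v h = mk⇔ (λ { (inj₁ e) → e }) inj₁

    right : ∀ v → ¬ Adj (G ⊔ᴳ H) i (g ↑ʳ v)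
    right v rewrite i≡u | splitAt-↑ʳ g h v = λ ()

  degree-⊔ʳ : ∀ {i u} → splitAt g {h} i ≡ inj₂ u → degree (G ⊔ᴳ H) i ≡ degree H u
  degree-⊔ʳ {i} {u} i≡u = begin
    degree (G ⊔ᴳ H) i
      ≡⟨ degree-∑ (G ⊔ᴳ H) i ⟩
    ∑[ j < g + h ] ι (Adj? (G ⊔ᴳ H) i j)
      ≡⟨ ∑-+ g h _ ⟩
    ∑[ v < g ] ι (Adj? (G ⊔ᴳ H) i (v ↑ˡ h)) + ∑[ v < h ] ι (Adj? (G ⊔ᴳ H) i (g ↑ʳ v))
      ≡⟨ cong₂ _+_ (∑.sum-cong-≗ λ v → ι-no (Adj? (G ⊔ᴳ H) i (v ↑ˡ h)) (left v))
                   (∑.sum-cong-≗ λ v → ι-cong (right v) (Adj? (G ⊔ᴳ H) i (g ↑ʳ v)) (Adj? H u v)) ⟩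
    ∑[ v < g ] 0 + ∑[ v < h ] ι (Adj? H u v)
      ≡⟨ cong₂ _+_ (∑.sum-replicate-zero g) (sym (degree-∑ H u)) ⟩
    degree H u ∎
    where
    left : ∀ v → ¬ Adj (G ⊔ᴳ H) i (v ↑ˡ h)
    left v rewrite i≡u | splitAt-↑ˡ g v h = λ ()

    right : ∀ v → Adj (G ⊔ᴳ H) i (g ↑ʳ v) ⇔ Adj H u v
    right v rewrite i≡u | splitAt-↑ʳ g h v = mk⇔ (λ { (inj₂ e) → e }) inj₂

-- Edge conditions under isomorphism and disjoint union, and on regular and biregular graphs

module _ (Q : ℕ → ℕ → Set) where

  -- An isomorphism preserves adjacency and degrees, and the condition refers to nothing else.
  Edgewise-≅ : ∀ {G H} → G ≅ H → Edgewise Q H → Edgewise Q G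
  Edgewise-≅ i q {u} {v} e =
    subst₂ Q (sym (degree-≅ i u)) (sym (degree-≅ i v)) (q (Equivalence.to (adj i u v) e))

  Edgewise-⊔ : ∀ {G H} → Edgewise Q G → Edgewise Q H → Edgewise Q (G ⊔ᴳ H)
  Edgewise-⊔ {G} {H} qG qH {i} {j} = transport refl refl
    where
    -- Abstracting the two `splitAt` values as `x` and `y` permits matching on the adjacency proof,
    -- while the equations still identify the vertices.
    transport : ∀ {x y} → splitAt (order G) i ≡ x → splitAt (order G) j ≡ y →
                Pointwise (Adj G) (Adj H) x y → Q (degree (G ⊔ᴳ H) i) (degree (G ⊔ᴳ H) j)
    transport i≡ j≡ (inj₁ e) = subst₂ Q (sym (degree-⊔ˡ G H i≡)) (sym (degree-⊔ˡ G H j≡)) (qG e)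
    transport i≡ j≡ (inj₂ e) = subst₂ Q (sym (degree-⊔ʳ G H i≡)) (sym (degree-⊔ʳ G H j≡)) (qH e)

  Edgewise-⨆ : ∀ {Hs : List Graph} → All (Edgewise Q) Hs → Edgewise Q (⨆ Hs)
  Edgewise-⨆ []                      {()}
  Edgewise-⨆ {H ∷ Hs} (q ∷ qs)       = Edgewise-⊔ {H} {⨆ Hs} q (Edgewise-⨆ qs)

  Edgewise-regular : ∀ {k} G → Q k k → RegularOf k G → Edgewise Q G
  Edgewise-regular G q reg {u} {v} _ = subst₂ Q (sym (reg u)) (sym (reg v)) q

  -- Class 1 excludes equal degrees at the ends of an edge, so these are `x` and `y` in one of the
  -- two orders. As `Q` may be asymmetric, both orders are assumed.
  Edgewise-biregular : ∀ {x y} G → Q x y → Q y x → BiregularOfClass1 x y G → Edgewise Q G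
  Edgewise-biregular G qxy qyx ((_ , D⊆ , _) , class1) {u} {v} e with D⊆ (u , refl) | D⊆ (v , refl)
  ... | inj₁ x≡u | inj₂ y≡v = subst₂ Q x≡u y≡v qxy
  ... | inj₂ y≡u | inj₁ x≡v = subst₂ Q y≡u x≡v qyx
  ... | inj₁ x≡u | inj₁ x≡v = contradiction e (class1 u v (trans (sym x≡u) x≡v))
  ... | inj₂ y≡u | inj₂ y≡v = contradiction e (class1 u v (trans (sym y≡u) y≡v))

-- Stars and cycles

-- A finite check over all pairs of the five vertices, settled by evaluating the decision procedure.
Edgewise-S₅ : Edgewise (λ x y → x * y ≡ 4) S₅
Edgewise-S₅ {u} {v} = from-yes
  (all? λ u → all? λ v → Adj? S₅ u v →-dec (degree S₅ u * degree S₅ v ≟ 4)) u v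

module _ (k : ℕ) .{{_ : NonZero k}} where

  %-absorbˡ : ∀ m n → (m % k + n) % k ≡ (m + n) % k
  %-absorbˡ m n = begin
    (m % k + n) % k             ≡⟨ %-distribˡ-+ (m % k) n k ⟩
    (m % k % k + n % k) % k     ≡⟨ cong (λ x → (x + n % k) % k) (m%n%n≡m%n m k) ⟩
    (m % k + n % k) % k         ≡⟨ %-distribˡ-+ m n k ⟨
    (m + n) % k                 ∎

module _ (ℓ : ℕ) where

  private
    k = 3 + ℓ

  -- Modulo `k = 3 + ℓ`, adding `2 + ℓ` amounts to subtracting 1. Together with `pred-%` this gives
  -- the predecessor on the cycle without truncated subtraction.
  suc-% : ∀ {i j : Fin k} → toℕ i ≡ suc (toℕ j) % k → (toℕ i + (2 + ℓ)) % k ≡ toℕ j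
  suc-% {i} {j} i≡1+j = begin
    (toℕ i + (2 + ℓ)) % k               ≡⟨ cong (λ x → (x + (2 + ℓ)) % k) i≡1+j ⟩
    (suc (toℕ j) % k + (2 + ℓ)) % k     ≡⟨ %-absorbˡ k (suc (toℕ j)) (2 + ℓ) ⟩
    (suc (toℕ j) + (2 + ℓ)) % k         ≡⟨ cong (_% k) (sym (+-suc (toℕ j) (2 + ℓ))) ⟩
    (toℕ j + k) % k                     ≡⟨ [m+n]%n≡m%n (toℕ j) k ⟩
    toℕ j % k                           ≡⟨ m<n⇒m%n≡m (toℕ<n j) ⟩
    toℕ j                               ∎

  pred-% : ∀ {i j : Fin k} → toℕ j ≡ (toℕ i + (2 + ℓ)) % k → suc (toℕ j) % k ≡ toℕ i
  pred-% {i} {j} j≡i-1 = begin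
    suc (toℕ j) % k                          ≡⟨ cong (_% k) (trans (+-comm 1 (toℕ j)) (cong (_+ 1) j≡i-1)) ⟩
    ((toℕ i + (2 + ℓ)) % k + 1) % k          ≡⟨ %-absorbˡ k (toℕ i + (2 + ℓ)) 1 ⟩
    (toℕ i + (2 + ℓ) + 1) % k                ≡⟨ cong (_% k) (shift (toℕ i) ℓ) ⟩
    (toℕ i + k) % k                          ≡⟨ [m+n]%n≡m%n (toℕ i) k ⟩
    toℕ i % k                                ≡⟨ m<n⇒m%n≡m (toℕ<n i) ⟩
    toℕ i                                    ∎
    where
    shift : ∀ a b → a + (2 + b) + 1 ≡ a + (3 + b)
    shift = solve-∀

  -- i ≡ i + 2 (mod k) is impossible as k ≥ 3
  no-2-cycle : ∀ {i j : Fin k} → toℕ j ≡ suc (toℕ i) % k → toℕ i ≢ suc (toℕ j) % k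
  no-2-cycle {i} {j} j≡1+i i≡1+j = absurd ((2 + toℕ i) / k) (+-cancelˡ-≡ (toℕ i) _ _ (begin
    toℕ i + 2                               ≡⟨ +-comm (toℕ i) 2 ⟩
    2 + toℕ i                               ≡⟨ m≡m%n+[m/n]*n (2 + toℕ i) k ⟩
    (2 + toℕ i) % k + ((2 + toℕ i) / k) * k    ≡⟨ cong (_+ ((2 + toℕ i) / k) * k) i+2≡i ⟩
    toℕ i + ((2 + toℕ i) / k) * k              ∎))
    where
    i+2≡i : (2 + toℕ i) % k ≡ toℕ i
    i+2≡i = begin
      (2 + toℕ i) % k                ≡⟨ cong (_% k) (+-comm (suc (toℕ i)) 1) ⟨
      (suc (toℕ i) + 1) % k          ≡⟨ %-absorbˡ k (suc (toℕ i)) 1 ⟨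
      (suc (toℕ i) % k + 1) % k      ≡⟨ cong (_% k) (trans (+-comm 1 (toℕ j)) (cong (_+ 1) j≡1+i)) ⟨
      suc (toℕ j) % k                ≡⟨ i≡1+j ⟨
      toℕ i                          ∎

    absurd : ∀ q → 2 ≢ q * k
    absurd zero    ()
    absurd (suc q) ()

  -- Each vertex has exactly one successor and exactly one predecessor, and `no-2-cycle` makes these
  -- distinct, so the two indicators add up.
  cycle-2-regular : RegularOf 2 (cycle ℓ)
  cycle-2-regular i = begin
    degree (cycle ℓ) i
      ≡⟨ degree-∑ (cycle ℓ) i ⟩
    ∑[ j < k ] ι (next? j ⊎-dec prev? j)
      ≡⟨ ∑.sum-cong-≗ (λ j → ι-⊎ (no-2-cycle {i} {j}) (next? j) (prev? j)) ⟩
    ∑[ j < k ] (ι (next? j) + ι (prev? j))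
      ≡⟨ ∑.∑-distrib-+ (ι ∘ next?) (ι ∘ prev?) ⟩
    ∑[ j < k ] ι (next? j) + ∑[ j < k ] ι (prev? j)
      ≡⟨ cong₂ _+_ (∑-ι-unique next? (fromℕ< succ<k) λ j → ≡-fromℕ< succ<k j)
                   (∑-ι-unique prev? (fromℕ< pred<k) λ j → mk⇔
                     (λ e → Equivalence.to (≡-fromℕ< pred<k j) (sym (suc-% {i} {j} e)))
                     (λ e → sym (pred-% {i} {j} (Equivalence.from (≡-fromℕ< pred<k j) e)))) ⟩
    2 ∎
    where
    next? : ∀ (j : Fin k) → Dec (toℕ j ≡ suc (toℕ i) % k)
    next? j = toℕ j ≟ suc (toℕ i) % k

    prev? : ∀ (j : Fin k) → Dec (toℕ i ≡ suc (toℕ j) % k)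
    prev? j = toℕ i ≟ suc (toℕ j) % k

    succ<k : suc (toℕ i) % k < k
    succ<k = m%n<n (suc (toℕ i)) k

    pred<k : (toℕ i + (2 + ℓ)) % k < k
    pred<k = m%n<n (toℕ i + (2 + ℓ)) k

    ≡-fromℕ< : ∀ {c} (c<k : c < k) (j : Fin k) → toℕ j ≡ c ⇔ j ≡ fromℕ< c<k
    ≡-fromℕ< c<k j = mk⇔ (λ e → toℕ-injective (trans e (sym (toℕ-fromℕ< c<k))))
                         (λ e → trans (cong toℕ e) (toℕ-fromℕ< c<k))

Edgewise-StarsAndCycles : ∀ {G} → StarsAndCycles G → Edgewise (λ x y → x * y ≡ 4) G
Edgewise-StarsAndCycles {G} (Hs , Hs-components , G≅) =
  Edgewise-≅ Q G≅ (Edgewise-⨆ Q (All.map component Hs-components))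
  where
  Q : ℕ → ℕ → Set
  Q x y = x * y ≡ 4

  component : ∀ {H} → H ≅ S₅ ⊎ ∃[ ℓ ] H ≅ cycle ℓ → Edgewise Q H
  component (inj₁ H≅)       = Edgewise-≅ Q H≅ λ {u} {v} → Edgewise-S₅ {u} {v}
  component (inj₂ (ℓ , H≅)) = Edgewise-≅ Q H≅ (Edgewise-regular Q (cycle ℓ) refl (cycle-2-regular ℓ))

-- Unions of regular graphs with a biregular graph of class 1

odd : ∀ {p} → 2 ∤ p → ∃[ q ] p ≡ suc (q * 2)
odd {p} 2∤p with p % 2 | m%n<n p 2 | m≡m%n+[m/n]*n p 2
... | 0            | _                              | p≡ = contradiction (divides (p / 2) p≡) 2∤p
... | 1            | _                              | p≡ = p / 2 , p≡
... | suc (suc _)  | s≤s (s≤s ()) | _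

-- For positive `x` and `y` the equation says that `k` is their harmonic mean, which is what the
-- edges of the biregular part need; on the regular parts `k * (k + k) = 2 * (k * k)` always holds.
Edgewise-RegularsAndBiregular : ∀ {k x y G} → RegularsAndBiregular k x y G → k * (x + y) ≡ 2 * (x * y) →
                                Edgewise (λ s t → k * (s + t) ≡ 2 * (s * t)) G
Edgewise-RegularsAndBiregular {k} {x} {y} {G} (Hs , B , Hs-regular , B-biregular , G≅) eq =
  Edgewise-≅ Q {G = G} G≅ (Edgewise-⊔ Q {G = ⨆ Hs} {H = B}
    (Edgewise-⨆ Q (All.map (λ {H} → Edgewise-regular Q H (diagonal k)) Hs-regular))
    (Edgewise-biregular Q B eq (trans (cong (k *_) (+-comm y x)) (trans eq (cong (2 *_) (*-comm x y)))) B-biregular))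
  where
  Q : ℕ → ℕ → Set
  Q s t = k * (s + t) ≡ 2 * (s * t)

  diagonal : ∀ k → k * (k + k) ≡ 2 * (k * k)
  diagonal = solve-∀

-- With `p = 2q + 1` the three halves are exact, namely `2q(q+1)`, `q(2q+1)` and `(2q+1)(q+1)`; both
-- sides then equal `2q(q+1)(2q+1)²`.
odd-degrees-ratio : ∀ {p} → 2 ∤ p →
  ((p ∸ 1) * (p + 1) / 2) * ((p ∸ 1) * p / 2 + p * (p + 1) / 2) ≡ 2 * (((p ∸ 1) * p / 2) * (p * (p + 1) / 2))
odd-degrees-ratio 2∤p with odd 2∤p
... | q , refl = begin
  q * 2 * (suc (q * 2) + 1) / 2 * (q * 2 * suc (q * 2) / 2 + suc (q * 2) * (suc (q * 2) + 1) / 2)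
    ≡⟨ cong₂ _*_ (halve {b = q * (2 + q * 2)} (k≡ q)) (cong₂ _+_ (halve {b = q * suc (q * 2)} (x≡ q)) (halve {b = suc (q * 2) * suc q} (y≡ q))) ⟩
  q * (2 + q * 2) * (q * suc (q * 2) + suc (q * 2) * suc q)
    ≡⟨ identity q ⟩
  2 * ((q * suc (q * 2)) * (suc (q * 2) * suc q))
    ≡⟨ cong (2 *_) (cong₂ _*_ (halve {b = q * suc (q * 2)} (x≡ q)) (halve {b = suc (q * 2) * suc q} (y≡ q))) ⟨
  2 * ((q * 2 * suc (q * 2) / 2) * (suc (q * 2) * (suc (q * 2) + 1) / 2)) ∎
  where
  halve : ∀ {a b} → a ≡ b * 2 → a / 2 ≡ b
  halve {b = b} refl = m*n/n≡m b 2
  k≡ : ∀ q → q * 2 * (suc (q * 2) + 1) ≡ q * (2 + q * 2) * 2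
  k≡ = solve-∀
  x≡ : ∀ q → q * 2 * suc (q * 2) ≡ q * suc (q * 2) * 2
  x≡ = solve-∀
  y≡ : ∀ q → suc (q * 2) * (suc (q * 2) + 1) ≡ suc (q * 2) * suc q * 2
  y≡ = solve-∀
  identity : ∀ q → q * (2 + q * 2) * (q * suc (q * 2) + suc (q * 2) * suc q)
                   ≡ 2 * ((q * suc (q * 2)) * (suc (q * 2) * suc q))
  identity = solve-∀

-- Passage to rational quotients and treatment of the four cases

-- Equality of unnormalised fractions is cross multiplication, and normalisation respects it. `mkℚᵘ`
-- stores the denominator minus one, hence the match on successors.
/-cong-× : ∀ a n b m .{{_ : NonZero n}} .{{_ : NonZero m}} → a * m ≡ b * n → (ℤ.+ a) ℚ./ n ≡ (ℤ.+ b) ℚ./ m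
/-cong-× a (suc n) b (suc m) eq = fromℚᵘ-cong {mkℚᵘ (ℤ.+ a) n} {mkℚᵘ (ℤ.+ b) m}
  (*≡* (trans (sym (pos-* a (suc m))) (trans (cong ℤ.+_ eq) (pos-* b (suc n)))))

-- The degrees sum to twice the size, so a graph of size 0 would give its first vertex degree 0.
size≢0 : ∀ G .{{_ : NonZero (order G)}} → (∀ v → NonZero (degree G v)) → NonZero (size G)
size≢0 G@record { order = suc n } d≢0 = ≢-nonZero λ m≡0 → ≢-nonZero⁻¹ (degree G zero) {{d≢0 zero}}
  (m+n≡0⇒m≡0 (degree G zero) (begin
    ∑[ v < suc n ] degree G v         ≡⟨ ∑.sum-cong-≗ (λ v → *-identityˡ (degree G v)) ⟨
    ∑[ v < suc n ] (1 * degree G v)   ≡⟨ handshake G (λ _ → 1) ⟩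
    edgeSum G (λ _ _ → 2)             ≡⟨ *-identityˡ _ ⟨
    1 * edgeSum G (λ _ _ → 2)         ≡⟨ edgeSum-proportional G 1 2 (λ _ _ → 2) (λ _ _ → 1) (λ _ → refl) ⟩
    2 * edgeSum G (λ _ _ → 1)         ≡⟨ cong (2 *_) (size-edgeSum G) ⟨
    2 * size G                        ≡⟨ cong (2 *_) m≡0 ⟩
    0                                 ∎))

theorem3p1 : (G : Graph) .{{_ : NonZero (order G)}} (a p : ℕ) → 0 < a → 0 < p →
    (D G ⊆ [ a ⋯ a + p ] × p * (p ∸ 1) / 2 ≤ a) ⊎ D G ⊆ [ 1 ⋯ 4 ] →
    Regular G
    ⊎ BiregularClass1 G
    ⊎ (2 ∤ p × RegularsAndBiregular ((p ∸ 1) * (p + 1) / 2) ((p ∸ 1) * p / 2) (p * (p + 1) / 2) G)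
    ⊎ StarsAndCycles G →
    ZagrebEquality G
theorem3p1 G a p 0<a 0<p D⊆ cases =
  size≢0 G d≢0 , /-cong-× (M₁ G) (order G) (M₂ G) (size G) {{it}} {{size≢0 G d≢0}} (cross cases)
  where
  d = degree G

  -- Either range bounds the degrees below by a positive number: by `a` in the first, by 1 in the
  -- second.
  d≢0 : ∀ v → NonZero (d v)
  d≢0 v = >-nonZero ([ (λ (D⊆[a,a+p] , _) → ≤-trans 0<a (proj₁ (D⊆[a,a+p] (v , refl))))
                     , (λ D⊆[1,4] → proj₁ (D⊆[1,4] (v , refl))) ]′ D⊆)

  -- The product of all degrees serves as the common multiple, and the quotients `N / d v` as the
  -- integral weights.
  N : ℕ
  N = product (map d (allFin (order G)))

  instance
    N≢0 : NonZero N
    N≢0 = product≢0 (All.map⁺ (All.universal d≢0 (allFin (order G))))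

  d∣N : ∀ v → d v ∣ N
  d∣N v = ∈⇒∣product (∈-map⁺ d (∈-allFin v))

  w : Vertex G → ℕ
  w v = _∣_.quotient (d∣N v)

  w*d≡N : ∀ v → w v * d v ≡ N
  w*d≡N v = sym (_∣_.equality (d∣N v))

  cross : Regular G ⊎ BiregularClass1 G
          ⊎ (2 ∤ p × RegularsAndBiregular ((p ∸ 1) * (p + 1) / 2) ((p ∸ 1) * p / 2) (p * (p + 1) / 2) G)
          ⊎ StarsAndCycles G →
          M₁ G * size G ≡ M₂ G * order G
  cross (inj₁ (k , reg)) = constant-product G N w w*d≡N (k * k) (Edgewise-regular (λ s t → s * t ≡ k * k) G refl reg)
  cross (inj₂ (inj₁ (x , y , bireg))) =
    constant-product G N w w*d≡N (x * y) (Edgewise-biregular (λ s t → s * t ≡ x * y) G refl (*-comm y x) bireg)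
  cross (inj₂ (inj₂ (inj₁ (2∤p , G-union)))) =
    -- The multipliers `(p² - 1)/2` and 2 are the ratio `(p² - 1) : 4` in halved form.
    constant-ratio G N w w*d≡N ((p ∸ 1) * (p + 1) / 2) 2 d≢0
      (Edgewise-RegularsAndBiregular {G = G} G-union (odd-degrees-ratio 2∤p))
  cross (inj₂ (inj₂ (inj₂ G-union))) = constant-product G N w w*d≡N 4 (Edgewise-StarsAndCycles {G} G-union)
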